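{- Let $G$ be a connected graph of order $n\ge 2$ and let $\Gamma$ be a family of nontrivial graphs such that $V(F)=V$ for every $F\in\Gamma$. Consider any function $h:V(G)\to\Gamma$. Then $$\lambda(G\circ_h\Gamma)=\min\{\lambda(G)|V|^2,\ \delta(G\circ_h\Gamma)\}.$$
   Context: All graphs are finite and simple. A graph is nontrivial if it has at least two vertices. For a graph $G$, a family of graphs $\Gamma$ and a function $h:V(G)\to\Gamma$, the product $G\circ_h\Gamma$ is the graph with vertex set $\bigcup_{a\in V(G)}\{(a,x): x\in V(h(a))\}$ in which $(a,x)(b,y)$ is an edge if and only if either $ab\in E(G)$, or $a=b$ and $xy\in E(h(a))$. The edge-connectivity $\lambda(G)$ is the minimum size of a set of edges whose deletion disconnects $G$, and $\delta(G)$ is the minimum degree of $G$. -}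

module Defs where

open import Level using (Level; 0ℓ)
open import Data.Nat.Base using (ℕ; _≤_)
open import Data.List.Base using (List; []; _∷_; _++_; map; concatMap; filter; length)
open import Data.List.Extrema.Nat using (min)
open import Data.List.Membership.Propositional using (_∈_; _∉_; lose)
open import Data.List.Membership.Propositional.Properties using (∈-map⁺; ∈-map⁻; ∈-concatMap⁺)
import Data.List.Membership.DecPropositional as DecMembership
import Data.List.Relation.Unary.All as All
import Data.List.Relation.Unary.All.Properties as All
open import Data.List.Relation.Unary.Any using (here; there)
import Data.List.Relation.Unary.AllPairs as AllPairs
import Data.List.Relation.Unary.AllPairs.Properties as AllPairs
open import Data.List.Relation.Unary.Unique.Propositional using (Unique)
import Data.List.Relation.Unary.Unique.Propositional.Properties as Unique
open import Data.Product.Base using (Σ; _×_; _,_; proj₁; uncurry)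
open import Data.Product.Properties using (≡-dec)
open import Data.Sum.Base using (_⊎_; inj₁; inj₂)
open import Relation.Binary.Core using (Rel)
open import Relation.Binary.Definitions using (Decidable; DecidableEquality; Symmetric; Irreflexive)
open import Relation.Binary.Construct.Closure.ReflexiveTransitive using (Star; ε; _◅_; _◅◅_)
open import Relation.Binary.PropositionalEquality using (_≡_; refl; sym; trans)
open import Relation.Nullary using (Dec; yes; no; contradiction)
open import Relation.Nullary.Decidable using (map′; ¬?; _×-dec_; _⊎-dec_)

private
  variable
    ℓ : Level
    A : Set ℓ

record FiniteSet : Set₁ where
  field
    Carrier  : Set
    _≟_      : DecidableEquality Carrier
    elements : List Carrier
    complete : ∀ x → x ∈ elements
    unique   : Unique elements

open FiniteSet public using (Carrier)

∣_∣ : FiniteSet → ℕ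
∣ V ∣ = length (FiniteSet.elements V)

Σᶠ : (U : FiniteSet) → (Carrier U → FiniteSet) → FiniteSet
Σᶠ U W = record
  { Carrier  = Σ (Carrier U) λ a → Carrier (W a)
  ; _≟_      = ≡-dec U._≟_ λ {a} → FiniteSet._≟_ (W a)
  ; elements = concatMap fibre U.elements
  ; complete = λ { (a , x) → ∈-concatMap⁺ fibre
                     (lose (U.complete a) (∈-map⁺ (a ,_) (FiniteSet.complete (W a) x))) }
  ; unique   = Unique.concat⁺
      (All.map⁺ (All.universal
        (λ a → Unique.map⁺ (λ { refl → refl }) (FiniteSet.unique (W a))) U.elements))
      (AllPairs.map⁺ (AllPairs.map
        (λ a≢b {_} (p , q) → a≢b (trans (sym (base p)) (base q))) U.unique))
  }
  where
  module U = FiniteSet U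

  fibre : (a : Carrier U) → List (Σ (Carrier U) λ a → Carrier (W a))
  fibre a = map (a ,_) (FiniteSet.elements (W a))

  base : ∀ {a z} → z ∈ fibre a → proj₁ z ≡ a
  base z∈ with _ , _ , refl ← ∈-map⁻ _ z∈ = refl

record Graph (V : FiniteSet) : Set₁ where
  field
    Adj    : Rel (Carrier V) 0ℓ
    adj?   : Decidable Adj
    symm   : Symmetric Adj
    irrefl : Irreflexive _≡_ Adj

Nontrivial : {V : FiniteSet} → Graph V → Set
Nontrivial {V} _ = 2 ≤ ∣ V ∣

Connected : {V : FiniteSet} → Graph V → Set
Connected G = ∀ u v → Star (Graph.Adj G) u v

-- Floyd–Warshall: Via ws u v holds when v is reached from u by a walk whose
-- interior vertices lie in ws.
module _ {V : FiniteSet} (G : Graph V) where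
  open FiniteSet V hiding (Carrier)
  open Graph G

  private
    Via : List (Carrier V) → Rel (Carrier V) 0ℓ
    Via []       u v = u ≡ v ⊎ Adj u v
    Via (w ∷ ws) u v = Via ws u v ⊎ (Via ws u w × Via ws w v)

    via? : ∀ ws → Decidable (Via ws)
    via? []       u v = (u ≟ v) ⊎-dec adj? u v
    via? (w ∷ ws) u v = via? ws u v ⊎-dec (via? ws u w ×-dec via? ws w v)

    via⇒walk : ∀ ws {u v} → Via ws u v → Star Adj u v
    via⇒walk []       (inj₁ refl)    = ε
    via⇒walk []       (inj₂ uv)      = uv ◅ ε
    via⇒walk (w ∷ ws) (inj₁ p)       = via⇒walk ws p
    via⇒walk (w ∷ ws) (inj₂ (p , q)) = via⇒walk ws p ◅◅ via⇒walk ws q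

    base⇒via : ∀ ws {u v} → u ≡ v ⊎ Adj u v → Via ws u v
    base⇒via []       p = p
    base⇒via (w ∷ ws) p = inj₁ (base⇒via ws p)

    join : ∀ {ws u w v} → w ∈ ws → Via ws u w → Via ws w v → Via ws u v
    join (here refl) (inj₁ p)       (inj₁ q)       = inj₂ (p , q)
    join (here refl) (inj₁ p)       (inj₂ (_ , q)) = inj₂ (p , q)
    join (here refl) (inj₂ (p , _)) (inj₁ q)       = inj₂ (p , q)
    join (here refl) (inj₂ (p , _)) (inj₂ (_ , q)) = inj₂ (p , q)
    join (there i)   (inj₁ p)       (inj₁ q)       = inj₁ (join i p q)
    join (there i)   (inj₁ p)       (inj₂ (q , r)) = inj₂ (join i p q , r)
    join (there i)   (inj₂ (p , q)) (inj₁ r)       = inj₂ (p , join i q r)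
    join (there i)   (inj₂ (p , _)) (inj₂ (_ , r)) = inj₂ (p , r)

    walk⇒via : ∀ {u v} → Star Adj u v → Via elements u v
    walk⇒via ε          = base⇒via elements (inj₁ refl)
    walk⇒via (uw ◅ wv) =
      join (complete _) (base⇒via elements (inj₂ uw)) (walk⇒via wv)

    walk? : Decidable (Star Adj)
    walk? u v = map′ (via⇒walk elements) walk⇒via (via? elements u v)

  connected? : Dec (Connected G)
  connected? =
    map′ (λ all u v → All.lookup (All.lookup all (complete u)) (complete v))
         (λ c → All.universal (λ u → All.universal (c u) elements) elements)
         (All.all? (λ u → All.all? (walk? u) elements) elements)

pairs : List A → List (A × A)
pairs []       = []
pairs (x ∷ xs) = map (x ,_) xs ++ pairs xs

sublists : List A → List (List A)
sublists []       = [] ∷ []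
sublists (x ∷ xs) = map (x ∷_) (sublists xs) ++ sublists xs

-- Each edge occurs exactly once, in the orientation given by the vertex
-- enumeration.
edges : {V : FiniteSet} → Graph V → List (Carrier V × Carrier V)
edges {V} G = filter (λ (u , v) → Graph.adj? G u v) (pairs (FiniteSet.elements V))

-- The pairs in S are read as unordered.
_∖_ : {V : FiniteSet} → Graph V → List (Carrier V × Carrier V) → Graph V
_∖_ {V} G S = record
  { Adj    = λ u v → Adj u v × (u , v) ∉ S × (v , u) ∉ S
  ; adj?   = λ u v → adj? u v ×-dec ¬? ((u , v) ∈? S) ×-dec ¬? ((v , u) ∈? S)
  ; symm   = λ (e , p , q) → symm e , q , p
  ; irrefl = λ eq (e , _) → irrefl eq e
  }
  where
  open Graph G
  open FiniteSet V using (_≟_)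
  open DecMembership (≡-dec _≟_ _≟_) using (_∈?_)

-- The first argument of min is a default.  It never affects the minimum when
-- there are at least two vertices, as deleting all edges then disconnects G;
-- it yields edge-connectivity 0 for the one-vertex graph.
edgeConnectivity : {V : FiniteSet} → Graph V → ℕ
edgeConnectivity G =
  min (length (edges G))
      (map length (filter (λ S → ¬? (connected? (G ∖ S))) (sublists (edges G))))

degree : {V : FiniteSet} → Graph V → Carrier V → ℕ
degree {V} G v = length (filter (Graph.adj? G v) (FiniteSet.elements V))

-- The default ∣ V ∣ exceeds every degree, so it matters only if V is empty.
minDegree : {V : FiniteSet} → Graph V → ℕ
minDegree {V} G = min ∣ V ∣ (map (degree G) (FiniteSet.elements V))

module _ {U : FiniteSet} (G : Graph U) {i} {I : Set i} (h : Carrier U → I)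
         {W : I → FiniteSet} (Γ : (i : I) → Graph (W i)) where

  data ProductAdj : Rel (Σ (Carrier U) λ a → Carrier (W (h a))) 0ℓ where
    between : ∀ {a b x y} → Graph.Adj G a b → ProductAdj (a , x) (b , y)
    within  : ∀ {a x y} → Graph.Adj (Γ (h a)) x y → ProductAdj (a , x) (a , y)

-- The family is indexed: Γ i ranges over its members, and h picks the index of
-- a member for each vertex of G.
_∘⟨_⟩_ : {U : FiniteSet} → Graph U → ∀ {i} {I : Set i} (h : Carrier U → I)
         {W : I → FiniteSet} → ((i : I) → Graph (W i)) →
         Graph (Σᶠ U λ a → W (h a))
_∘⟨_⟩_ {U} G h {W} Γ = record
  { Adj    = ProductAdj G h Γ
  ; adj?   = dec
  ; symm   = λ { (between e) → between (Graph.symm G e)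
               ; (within e)  → within (Graph.symm (Γ (h _)) e) }
  ; irrefl = λ { refl (between e) → Graph.irrefl G refl e
               ; refl (within e)  → Graph.irrefl (Γ (h _)) refl e }
  }
  where
  dec : Decidable (ProductAdj G h Γ)
  dec (a , x) (b , y) with Graph.adj? G a b
  ... | yes e = yes (between e)
  ... | no ¬e with FiniteSet._≟_ U a b
  ...   | no a≢b = no λ { (between e) → ¬e e ; (within _) → a≢b refl }
  ...   | yes refl = map′ within (λ { (between e) → contradiction e ¬e ; (within e) → e })
                       (Graph.adj? (Γ (h a)) x y)

{-# OPTIONS --safe #-}
module Submission where

-- The edge-connectivity is the minimum number of edges leaving a proper vertex
-- set X.  In the product, with n = |V| and k a the size of the fibre of X over
-- a, the edges between distinct fibres contribute the sum of k a * (n − k b)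
-- over the ordered adjacent pairs (a , b).  This sum is affine in each single
-- k a, so fibres can be rounded to empty or full without increasing it.  If no
-- fibre of X is split, X comes from a proper set of G and at least λ(G) n²
-- edges leave it.  Otherwise fix a split fibre a and round all the others: if
-- they do not all agree, rounding a too gives λ(G) n² again; if they are all
-- empty, say, then the between-fibre edges number at least deg a * n * k a,
-- which together with the untouched edges inside the fibre is at least the
-- degree of a vertex of X over a.

open import Defs
open import Level using (Level)
open import Function.Base using (_∘_; id; case_of_)
open import Function.Bundles using (mk⇔)
open import Data.Bool.Base using (Bool; true; false; not; if_then_else_)
import Data.Bool.Properties as Bool
open import Data.Empty using (⊥-elim)
open import Data.List.Base using (List; []; _∷_; _++_; map; concatMap; filter; length)
open import Data.List.Extrema.Nat using (argmin-sel; min≤v⁺; v≤min⁺; min≤xs)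
open import Data.List.Membership.Propositional using (_∈_; _∉_; lose; find)
open import Data.List.Membership.Propositional.Properties
  using (∈-map⁺; ∈-map⁻; ∈-++⁺ˡ; ∈-++⁺ʳ; ∈-++⁻; ∈-filter⁺; ∈-filter⁻; ∈-map∘filter⁻; ∈-∃++)
open import Data.List.Properties
  using (filter-accept; filter-reject; filter-all; length-filter; map-++; map-∘)
import Data.List.Membership.DecPropositional as DecMembership
open import Data.List.Relation.Binary.Permutation.Propositional.Properties using (shift; ↭-length)
open import Data.List.Relation.Binary.Subset.Propositional using (_⊆_)
open import Data.List.Relation.Unary.All as All using (All; []; _∷_)
import Data.List.Relation.Unary.All.Properties as All
open import Data.List.Relation.Unary.AllPairs using ([]; _∷_)
open import Data.List.Relation.Unary.Any using (here; there)
open import Data.List.Relation.Unary.Unique.Propositional using (Unique)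
import Data.List.Relation.Unary.Unique.Propositional.Properties as Unique
open import Data.Nat.Base using (ℕ; zero; suc; _+_; _*_; _^_; _⊓_; _≤_; z≤n; s≤s)
open import Data.Nat.ListAction using (sum)
open import Data.Nat.ListAction.Properties using (sum-++)
open import Data.Nat.Properties as ℕ hiding (_≟_)
open import Data.Nat.Tactic.RingSolver using (solve-∀)
open import Data.Product.Base using (∃; ∃₂; _×_; _,_; proj₁; proj₂; swap; uncurry)
open import Data.Product.Properties using (≡-dec)
open import Data.Sum.Base using (_⊎_; inj₁; inj₂)
open import Relation.Binary.Construct.Closure.ReflexiveTransitive using (Star; ε; _◅_; _◅◅_)
open import Relation.Binary.PropositionalEquality
open import Relation.Nullary using (¬_; Dec; yes; no; does; contradiction)
open import Relation.Nullary.Decidable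
  using (¬?; _⊎-dec_; decidable-stable; ¬¬-excluded-middle; dec-true; dec-false; does-⇔)
open import Relation.Unary using (Pred; Decidable)

private
  variable
    a b p q : Level
    A : Set a
    B : Set b

-- Finite sums over lists.

∑ : List A → (A → ℕ) → ℕ
∑ xs f = sum (map f xs)

infixr 8 ∑
syntax ∑ xs (λ x → e) = ∑[ x ∈ xs ] e

⟦_⟧ : Bool → ℕ
⟦ β ⟧ = if β then 1 else 0

∑-cong : ∀ (xs : List A) {f g : A → ℕ} → (∀ {x} → x ∈ xs → f x ≡ g x) → ∑ xs f ≡ ∑ xs g
∑-cong []       eq = refl
∑-cong (x ∷ xs) eq = cong₂ _+_ (eq (here refl)) (∑-cong xs (eq ∘ there))

∑-mono : ∀ (xs : List A) {f g : A → ℕ} → (∀ x → f x ≤ g x) → ∑ xs f ≤ ∑ xs g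
∑-mono []       le = z≤n
∑-mono (x ∷ xs) le = +-mono-≤ (le x) (∑-mono xs le)

∑-zero : ∀ (xs : List A) {f : A → ℕ} → (∀ x → f x ≡ 0) → ∑ xs f ≡ 0
∑-zero []       eq = refl
∑-zero (x ∷ xs) eq = cong₂ _+_ (eq x) (∑-zero xs eq)

∑-++ : ∀ (xs ys : List A) (f : A → ℕ) → ∑ (xs ++ ys) f ≡ ∑ xs f + ∑ ys f
∑-++ xs ys f = trans (cong sum (map-++ f xs ys)) (sum-++ (map f xs) (map f ys))

∑-map : ∀ (g : A → B) (xs : List A) (f : B → ℕ) → ∑ (map g xs) f ≡ ∑ xs (f ∘ g)
∑-map g xs f = cong sum (sym (map-∘ xs))

∑-concatMap : ∀ (g : A → List B) xs (f : B → ℕ) → ∑ (concatMap g xs) f ≡ ∑[ x ∈ xs ] ∑ (g x) f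
∑-concatMap g []       f = refl
∑-concatMap g (x ∷ xs) f =
  trans (∑-++ (g x) (concatMap g xs) f) (cong (∑ (g x) f +_) (∑-concatMap g xs f))

∑-+ : ∀ (xs : List A) (f g : A → ℕ) → ∑[ x ∈ xs ] (f x + g x) ≡ ∑ xs f + ∑ xs g
∑-+ []       f g = refl
∑-+ (x ∷ xs) f g = trans (cong (f x + g x +_) (∑-+ xs f g)) (interchange (f x) (g x) _ _)
  where
  interchange : ∀ k l m n → k + l + (m + n) ≡ k + m + (l + n)
  interchange = solve-∀

∑-*ˡ : ∀ (xs : List A) c (f : A → ℕ) → ∑[ x ∈ xs ] (c * f x) ≡ c * ∑ xs f
∑-*ˡ []       c f = sym (*-zeroʳ c)
∑-*ˡ (x ∷ xs) c f = trans (cong (c * f x +_) (∑-*ˡ xs c f)) (sym (*-distribˡ-+ c (f x) _))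

∑-*ʳ : ∀ (xs : List A) c (f : A → ℕ) → ∑[ x ∈ xs ] (f x * c) ≡ ∑ xs f * c
∑-*ʳ xs c f = begin
  ∑[ x ∈ xs ] (f x * c)  ≡⟨ ∑-cong xs (λ {x} _ → *-comm (f x) c) ⟩
  ∑[ x ∈ xs ] (c * f x)  ≡⟨ ∑-*ˡ xs c f ⟩
  c * ∑ xs f             ≡⟨ *-comm c (∑ xs f) ⟩
  ∑ xs f * c             ∎
  where open ≡-Reasoning

∑-swap : ∀ (xs : List A) (ys : List B) (f : A → B → ℕ) →
         ∑[ x ∈ xs ] ∑[ y ∈ ys ] f x y ≡ ∑[ y ∈ ys ] ∑[ x ∈ xs ] f x y
∑-swap []       ys f = sym (∑-zero ys (λ _ → refl))
∑-swap (x ∷ xs) ys f =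
  trans (cong (∑ ys (f x) +_) (∑-swap xs ys f)) (sym (∑-+ ys (f x) _))

∑-1 : ∀ (xs : List A) → ∑[ x ∈ xs ] 1 ≡ length xs
∑-1 []       = refl
∑-1 (x ∷ xs) = cong suc (∑-1 xs)

∑-const : ∀ (xs : List A) c → ∑[ x ∈ xs ] c ≡ length xs * c
∑-const []       c = refl
∑-const (x ∷ xs) c = cong (c +_) (∑-const xs c)

-- Filters, sublists and lists without repetition.

module _ {A : Set a} {P : Pred A p} (P? : Decidable P) where

  ∑-filter : ∀ xs (f : A → ℕ) → ∑ (filter P? xs) f ≡ ∑[ x ∈ xs ] (⟦ does (P? x) ⟧ * f x)
  ∑-filter []       f = refl
  ∑-filter (x ∷ xs) f with does (P? x)
  ... | true  = cong₂ _+_ (sym (+-identityʳ (f x))) (∑-filter xs f)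
  ... | false = ∑-filter xs f

  length-filter≡∑ : ∀ xs → length (filter P? xs) ≡ ∑[ x ∈ xs ] ⟦ does (P? x) ⟧
  length-filter≡∑ xs = begin
    length (filter P? xs)             ≡⟨ ∑-1 (filter P? xs) ⟨
    ∑[ x ∈ filter P? xs ] 1           ≡⟨ ∑-filter xs (λ _ → 1) ⟩
    ∑[ x ∈ xs ] (⟦ does (P? x) ⟧ * 1)  ≡⟨ ∑-cong xs (λ _ → *-identityʳ _) ⟩
    ∑[ x ∈ xs ] ⟦ does (P? x) ⟧       ∎
    where open ≡-Reasoning

  -- Puts the edges across a vertex set among the candidates over which `edgeConnectivity`
  -- minimises.
  filter∈sublists : ∀ xs → filter P? xs ∈ sublists xs
  filter∈sublists []       = here refl
  filter∈sublists (x ∷ xs) with does (P? x)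
  ... | true  = ∈-++⁺ˡ (∈-map⁺ (x ∷_) (filter∈sublists xs))
  ... | false = ∈-++⁺ʳ _ (filter∈sublists xs)

sublist⇒⊆ : ∀ (xs : List A) {S} → S ∈ sublists xs → S ⊆ xs
sublist⇒⊆ []       (here refl) ()
sublist⇒⊆ (x ∷ xs) S∈ z∈ with ∈-++⁻ (map (x ∷_) (sublists xs)) S∈
... | inj₂ S∈′ = there (sublist⇒⊆ xs S∈′ z∈)
... | inj₁ S∈′ with ∈-map⁻ (x ∷_) S∈′ | z∈
...   | S′ , _  , refl | here refl = here refl
...   | S′ , S″ , refl | there z∈′ = there (sublist⇒⊆ xs S″ z∈′)

-- One occurrence of `x` is cut out of `ys`; the later entries of `xs` differ from `x`, so they
-- survive in what is left and the induction applies.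
length-mono-⊆ : ∀ {xs ys : List A} → Unique xs → xs ⊆ ys → length xs ≤ length ys
length-mono-⊆ {xs = []}     _         _     = z≤n
length-mono-⊆ {xs = x ∷ xs} (x≢ ∷ u) xs⊆ys with ∈-∃++ (xs⊆ys (here refl))
... | ys₁ , ys₂ , refl = begin
  suc (length xs)             ≤⟨ s≤s (length-mono-⊆ u xs⊆) ⟩
  suc (length (ys₁ ++ ys₂))   ≡⟨ ↭-length (shift x ys₁ ys₂) ⟨
  length (ys₁ ++ x ∷ ys₂)     ∎
  where
  open ≤-Reasoning
  xs⊆ : xs ⊆ ys₁ ++ ys₂
  xs⊆ z∈ with ∈-++⁻ ys₁ (xs⊆ys (there z∈))
  ... | inj₁ z∈₁         = ∈-++⁺ˡ z∈₁
  ... | inj₂ (here refl) = contradiction refl (All.lookup x≢ z∈)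
  ... | inj₂ (there z∈₂) = ∈-++⁺ʳ ys₁ z∈₂

-- Unordered pairs from a list.

∈-pairs⁻ : ∀ (xs : List A) {x y} → (x , y) ∈ pairs xs → x ∈ xs × y ∈ xs
∈-pairs⁻ (x ∷ xs) xy∈ with ∈-++⁻ (map (x ,_) xs) xy∈
... | inj₂ xy∈′ = let x∈ , y∈ = ∈-pairs⁻ xs xy∈′ in there x∈ , there y∈
... | inj₁ xy∈′ with ∈-map⁻ (x ,_) xy∈′
...   | y , y∈ , refl = here refl , there y∈

∈-pairs⁺ : ∀ {xs : List A} {x y} → x ∈ xs → y ∈ xs → x ≢ y →
           (x , y) ∈ pairs xs ⊎ (y , x) ∈ pairs xs
∈-pairs⁺ (here refl) (here refl) x≢y = contradiction refl x≢y
∈-pairs⁺ (here refl) (there y∈)  _   = inj₁ (∈-++⁺ˡ (∈-map⁺ _ y∈))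
∈-pairs⁺ (there x∈)  (here refl) _   = inj₂ (∈-++⁺ˡ (∈-map⁺ _ x∈))
∈-pairs⁺ (there x∈)  (there y∈)  x≢y with ∈-pairs⁺ x∈ y∈ x≢y
... | inj₁ xy∈ = inj₁ (∈-++⁺ʳ _ xy∈)
... | inj₂ yx∈ = inj₂ (∈-++⁺ʳ _ yx∈)

-- Edge deletion reads pairs as unordered; this excludes that an edge and its reversal are both
-- listed in `edges G`.
pairs-asym : ∀ {xs : List A} {x y} → Unique xs → (x , y) ∈ pairs xs → (y , x) ∉ pairs xs
pairs-asym {xs = x ∷ xs} (x≢ ∷ u) xy∈ yx∈
  with ∈-++⁻ (map (x ,_) xs) xy∈ | ∈-++⁻ (map (x ,_) xs) yx∈
... | inj₂ xy∈′ | inj₂ yx∈′ = pairs-asym u xy∈′ yx∈′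
... | inj₁ xy∈′ | inj₂ yx∈′ with ∈-map⁻ (x ,_) xy∈′
...   | _ , _ , refl = All.lookup x≢ (proj₂ (∈-pairs⁻ xs yx∈′)) refl
pairs-asym {xs = x ∷ xs} (x≢ ∷ u) xy∈ yx∈
    | inj₂ xy∈′ | inj₁ yx∈′ with ∈-map⁻ (x ,_) yx∈′
...   | _ , _ , refl = All.lookup x≢ (proj₂ (∈-pairs⁻ xs xy∈′)) refl
pairs-asym {xs = x ∷ xs} (x≢ ∷ u) xy∈ yx∈
    | inj₁ xy∈′ | inj₁ yx∈′ with ∈-map⁻ (x ,_) xy∈′ | ∈-map⁻ (x ,_) yx∈′
...   | _ , y∈ , refl | _ , _ , refl = All.lookup x≢ y∈ refl

pairs-unique : ∀ {xs : List A} → Unique xs → Unique (pairs xs)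
pairs-unique {xs = []}     []       = []
pairs-unique {xs = x ∷ xs} (x≢ ∷ u) =
  Unique.++⁺ (Unique.map⁺ (λ { refl → refl }) u) (pairs-unique u) disjoint
  where
  disjoint : ∀ {z} → z ∈ map (x ,_) xs × z ∈ pairs xs → _
  disjoint (z∈ , z∈′) with ∈-map⁻ (x ,_) z∈
  ... | _ , _ , refl = All.lookup x≢ (proj₁ (∈-pairs⁻ xs z∈′)) refl

-- The ordered pairs consist of the diagonal, where `f` vanishes, and two triangles exchanged by
-- `swap`. The induction peels off the row and the column of the head.
∑-pairs : ∀ (xs : List A) (f : A → A → ℕ) → (∀ x → f x x ≡ 0) →
          ∑[ e ∈ pairs xs ] (uncurry f e + uncurry f (swap e)) ≡ ∑[ x ∈ xs ] ∑[ y ∈ xs ] f x y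
∑-pairs []       f f≡0 = refl
∑-pairs (x ∷ xs) f f≡0 = begin
  ∑ (map (x ,_) xs ++ pairs xs) g
    ≡⟨ ∑-++ (map (x ,_) xs) (pairs xs) g ⟩
  ∑ (map (x ,_) xs) g + ∑ (pairs xs) g
    ≡⟨ cong₂ _+_ (trans (∑-map (x ,_) xs g) (∑-+ xs (f x) (λ y → f y x))) (∑-pairs xs f f≡0) ⟩
  ∑ xs (f x) + ∑[ y ∈ xs ] f y x + ∑[ z ∈ xs ] ∑ xs (f z)
    ≡⟨ +-assoc (∑ xs (f x)) _ _ ⟩
  ∑ xs (f x) + (∑[ y ∈ xs ] f y x + ∑[ z ∈ xs ] ∑ xs (f z))
    ≡⟨ cong₂ _+_ (cong (_+ ∑ xs (f x)) (f≡0 x)) (∑-+ xs (λ y → f y x) _) ⟨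
  (f x x + ∑ xs (f x)) + ∑[ z ∈ xs ] (f z x + ∑ xs (f z))
    ∎
  where
  open ≡-Reasoning
  g = λ e → uncurry f e + uncurry f (swap e)

-- Enumerated finite sets.

module Enumeration (V : FiniteSet) where
  open FiniteSet V public hiding (Carrier) renaming (elements to E)

  others : Carrier V → List (Carrier V)
  others x = filter (λ y → ¬? (y ≟ x)) E

  ∈-others⁺ : ∀ {x y} → y ≢ x → y ∈ others x
  ∈-others⁺ = ∈-filter⁺ _ (complete _)

  ∈-others⁻ : ∀ {x y} → y ∈ others x → y ≢ x
  ∈-others⁻ {x} = proj₂ ∘ ∈-filter⁻ (λ y → ¬? (y ≟ x)) {xs = E}

  ∑-at : ∀ x (f : Carrier V → ℕ) → ∑ E f ≡ f x + ∑ (others x) f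
  ∑-at x f = go unique (complete x)
    where
    open ≡-Reasoning
    ≢x? : Decidable (_≢ x)
    ≢x? y = ¬? (y ≟ x)

    go : ∀ {xs} → Unique xs → x ∈ xs → ∑ xs f ≡ f x + ∑ (filter ≢x? xs) f
    go {_ ∷ xs} (x≢ ∷ u) (here refl) = cong (λ ys → f x + ∑ ys f) (begin
      xs                    ≡⟨ filter-all ≢x? (All.map (_∘ sym) x≢) ⟨
      filter ≢x? xs         ≡⟨ filter-reject ≢x? (λ x≢x → x≢x refl) ⟨
      filter ≢x? (x ∷ xs)   ∎)
    go {y ∷ xs} (y≢ ∷ u) (there x∈) = begin
      f y + ∑ xs f                         ≡⟨ cong (f y +_) (go u x∈) ⟩
      f y + (f x + ∑ (filter ≢x? xs) f)    ≡⟨ exchange (f y) (f x) _ ⟩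
      f x + (f y + ∑ (filter ≢x? xs) f)    ≡⟨ cong (λ ys → f x + ∑ ys f)
                                                (filter-accept ≢x? (All.lookup y≢ x∈)) ⟨
      f x + ∑ (filter ≢x? (y ∷ xs)) f      ∎
      where
      exchange : ∀ k l m → k + (l + m) ≡ l + (k + m)
      exchange = solve-∀

  term≤∑ : ∀ x (f : Carrier V → ℕ) → f x ≤ ∑ E f
  term≤∑ x f = ≤-trans (m≤m+n (f x) _) (≤-reflexive (sym (∑-at x f)))

  distinct : 2 ≤ ∣ V ∣ → ∃₂ λ (x y : Carrier V) → x ≢ y
  distinct 2≤ = go E unique 2≤
    where
    go : ∀ xs → Unique xs → 2 ≤ length xs → ∃₂ λ (x y : Carrier V) → x ≢ y
    go (x ∷ y ∷ _) ((x≢y ∷ _) ∷ _) _ = x , y , x≢y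
    go (_ ∷ [])    _ (s≤s ())

  another : 2 ≤ ∣ V ∣ → ∀ (x : Carrier V) → ∃ λ y → y ≢ x
  another 2≤ x with distinct 2≤
  ... | y , z , y≢z with y ≟ x
  ...   | no y≢x   = y , y≢x
  ...   | yes refl = z , y≢z ∘ sym

-- Each instance is decided under a double negation, and along a finite enumeration these double
-- negations can be collected into a single one.
¬¬-decide : (V : FiniteSet) (P : Carrier V → Set p) → ¬ ¬ (∀ x → Dec (P x))
¬¬-decide V P k = go E λ all → k λ x → All.lookup all (complete x)
  where
  open Enumeration V
  go : ∀ xs → ¬ ¬ All (Dec ∘ P) xs
  go []       k = k []
  go (x ∷ xs) k = ¬¬-excluded-middle λ d → go xs λ ds → k (d ∷ ds)

-- Vertex sets and their edge cuts.

Proper : {V : FiniteSet} → (Carrier V → Bool) → Set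
Proper {V} X = ∃₂ λ (x y : Carrier V) → X x ≡ true × X y ≡ false

≢⇒proper : ∀ {V : FiniteSet} (X : Carrier V → Bool) {x y} → X x ≢ X y → Proper {V} X
≢⇒proper X {x} {y} x≢y with X x in eqx | X y in eqy
... | true  | true  = contradiction refl x≢y
... | true  | false = x , y , eqx , eqy
... | false | true  = y , x , eqy , eqx
... | false | false = contradiction refl x≢y

module Cut {V : FiniteSet} (G : Graph V) where
  open Enumeration V
  open Graph G

  adj : Carrier V → Carrier V → ℕ
  adj x y = ⟦ does (adj? x y) ⟧

  adj-irrefl : ∀ x → adj x x ≡ 0
  adj-irrefl x = cong ⟦_⟧ (dec-false (adj? x x) (irrefl refl))

  adj-sym : ∀ x y → adj x y ≡ adj y x
  adj-sym x y = cong ⟦_⟧ (does-⇔ (mk⇔ symm symm) (adj? x y) (adj? y x))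

  degree≡∑ : ∀ x → degree G x ≡ ∑ E (adj x)
  degree≡∑ x = length-filter≡∑ (adj? x) E

  degree≡∑-others : ∀ x → degree G x ≡ ∑ (others x) (adj x)
  degree≡∑-others x =
    trans (degree≡∑ x) (trans (∑-at x (adj x)) (cong (_+ ∑ (others x) (adj x)) (adj-irrefl x)))

  -- Summing over ordered pairs counts each edge across the cut exactly once,
  -- at the orientation leaving X.
  crossing : (Carrier V → Bool) → Carrier V → Carrier V → ℕ
  crossing X x y = adj x y * (⟦ X x ⟧ * ⟦ not (X y) ⟧)

  cut : (Carrier V → Bool) → ℕ
  cut X = ∑[ x ∈ E ] ∑[ y ∈ E ] crossing X x y

  crosses? : (X : Carrier V → Bool) → Decidable λ ((x , y) : Carrier V × Carrier V) → X x ≢ X y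
  crosses? X (x , y) = ¬? (X x Bool.≟ X y)

  cutEdges : (Carrier V → Bool) → List (Carrier V × Carrier V)
  cutEdges X = filter (crosses? X) (edges G)

  -- `edges G` holds one orientation of each edge, while `cut` runs over both. The ends of an edge
  -- are separated iff exactly one of its orientations leaves `X`, so the two counts agree.
  length-cutEdges : ∀ X → length (cutEdges X) ≡ cut X
  length-cutEdges X = begin
    length (cutEdges X)
      ≡⟨ length-filter≡∑ (crosses? X) (edges G) ⟩
    ∑[ e ∈ edges G ] ⟦ does (crosses? X e) ⟧
      ≡⟨ ∑-filter (uncurry adj?) (pairs E) _ ⟩
    ∑[ e ∈ pairs E ] (uncurry adj e * ⟦ does (crosses? X e) ⟧)
      ≡⟨ ∑-cong (pairs E) (λ {e} _ → orient e) ⟩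
    ∑[ e ∈ pairs E ] (uncurry (crossing X) e + uncurry (crossing X) (swap e))
      ≡⟨ ∑-pairs E (crossing X) (λ x → cong (_* (⟦ X x ⟧ * ⟦ not (X x) ⟧)) (adj-irrefl x)) ⟩
    cut X
      ∎
    where
    open ≡-Reasoning
    xor : ∀ β γ → ⟦ does (¬? (β Bool.≟ γ)) ⟧ ≡ ⟦ β ⟧ * ⟦ not γ ⟧ + ⟦ γ ⟧ * ⟦ not β ⟧
    xor true  true  = refl
    xor true  false = refl
    xor false true  = refl
    xor false false = refl

    orient : ∀ e → uncurry adj e * ⟦ does (crosses? X e) ⟧ ≡
                   uncurry (crossing X) e + uncurry (crossing X) (swap e)
    orient (x , y) = begin
      adj x y * ⟦ does (crosses? X (x , y)) ⟧
        ≡⟨ cong (adj x y *_) (xor (X x) (X y)) ⟩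
      adj x y * (⟦ X x ⟧ * ⟦ not (X y) ⟧ + ⟦ X y ⟧ * ⟦ not (X x) ⟧)
        ≡⟨ *-distribˡ-+ (adj x y) _ _ ⟩
      crossing X x y + adj x y * (⟦ X y ⟧ * ⟦ not (X x) ⟧)
        ≡⟨ cong (λ k → crossing X x y + k * _) (adj-sym x y) ⟩
      crossing X x y + crossing X y x
        ∎

  -- Complementation reverses the orientation of every crossing pair. In `lower-bound` it lets the
  -- part of a fibre outside `X` take the place of the part inside.
  cut-complement : ∀ X → cut (not ∘ X) ≡ cut X
  cut-complement X = begin
    ∑[ x ∈ E ] ∑[ y ∈ E ] crossing (not ∘ X) x y  ≡⟨ ∑-cong E (λ {x} _ → ∑-cong E λ {y} _ → flip x y) ⟩
    ∑[ x ∈ E ] ∑[ y ∈ E ] crossing X y x          ≡⟨ ∑-swap E E (λ x y → crossing X y x) ⟩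
    cut X                                          ∎
    where
    open ≡-Reasoning
    flip : ∀ x y → crossing (not ∘ X) x y ≡ crossing X y x
    flip x y = cong₂ _*_ (adj-sym x y)
      (trans (cong (λ β → ⟦ not (X x) ⟧ * ⟦ β ⟧) (Bool.not-involutive (X y)))
             (*-comm ⟦ not (X x) ⟧ ⟦ X y ⟧))

  -- The left side is the row of `x` in the double sum `cut X`.
  out-degree≤cut : ∀ X {x} → X x ≡ true → ∑[ y ∈ E ] (adj x y * ⟦ not (X y) ⟧) ≤ cut X
  out-degree≤cut X {x} x∈X = begin
    ∑[ y ∈ E ] (adj x y * ⟦ not (X y) ⟧)  ≡⟨ ∑-cong E (λ {y} _ → cong (adj x y *_) (leaving y)) ⟩
    ∑[ y ∈ E ] crossing X x y             ≤⟨ term≤∑ x (λ x → ∑[ y ∈ E ] crossing X x y) ⟩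
    cut X                                 ∎
    where
    open ≤-Reasoning
    leaving : ∀ y → ⟦ not (X y) ⟧ ≡ ⟦ X x ⟧ * ⟦ not (X y) ⟧
    leaving y rewrite x∈X = sym (+-identityʳ _)

  -- A vertex of X has at most |X| − 1 of its neighbours inside X.
  degree<cut+size : ∀ X {x} → X x ≡ true → suc (degree G x) ≤ cut X + ∑[ y ∈ E ] ⟦ X y ⟧
  degree<cut+size X {x} x∈X = begin
    suc (degree G x)
      ≡⟨ cong suc (degree≡∑-others x) ⟩
    suc (∑ (others x) (adj x))
      ≤⟨ s≤s (∑-mono (others x) (λ y → bound (adj x y) (X y) (adj≤1 y))) ⟩
    suc (∑[ y ∈ others x ] (out y + ⟦ X y ⟧))
      ≡⟨ cong suc (∑-+ (others x) out _) ⟩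
    suc (∑ (others x) out + ∑[ y ∈ others x ] ⟦ X y ⟧)
      ≡⟨ +-suc (∑ (others x) out) _ ⟨
    ∑ (others x) out + suc (∑[ y ∈ others x ] ⟦ X y ⟧)
      ≡⟨ cong (λ β → ∑ (others x) out + (⟦ β ⟧ + ∑[ y ∈ others x ] ⟦ X y ⟧)) x∈X ⟨
    ∑ (others x) out + (⟦ X x ⟧ + ∑[ y ∈ others x ] ⟦ X y ⟧)
      ≤⟨ +-monoˡ-≤ _ (m≤n+m (∑ (others x) out) (out x)) ⟩
    (out x + ∑ (others x) out) + (⟦ X x ⟧ + ∑[ y ∈ others x ] ⟦ X y ⟧)
      ≡⟨ cong₂ _+_ (∑-at x out) (∑-at x (λ y → ⟦ X y ⟧)) ⟨
    ∑ E out + ∑[ y ∈ E ] ⟦ X y ⟧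
      ≤⟨ +-monoˡ-≤ _ (out-degree≤cut X x∈X) ⟩
    cut X + ∑[ y ∈ E ] ⟦ X y ⟧
      ∎
    where
    open ≤-Reasoning
    out = λ y → adj x y * ⟦ not (X y) ⟧

    adj≤1 : ∀ y → adj x y ≤ 1
    adj≤1 y with does (adj? x y)
    ... | true  = ≤-refl
    ... | false = z≤n

    -- A neighbour outside `X` is paid for by the edge towards it, one inside `X` by its own
    -- membership.
    bound : ∀ k β → k ≤ 1 → k ≤ k * ⟦ not β ⟧ + ⟦ β ⟧
    bound k true  k≤1 = ≤-trans k≤1 (m≤n+m 1 (k * 0))
    bound k false k≤1 = ≤-reflexive (sym (trans (+-identityʳ _) (*-identityʳ k)))

  singleton : Carrier V → Carrier V → Bool
  singleton x y = does (y ≟ x)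

  singleton-proper : 2 ≤ ∣ V ∣ → ∀ x → Proper {V} (singleton x)
  singleton-proper 2≤ x =
    let y , y≢x = another 2≤ x in x , y , dec-true (x ≟ x) refl , dec-false (y ≟ x) y≢x

  -- Only the row of `x` contributes: every other row carries the indicator of a vertex outside the
  -- singleton.
  cut-singleton≤degree : ∀ x → cut (singleton x) ≤ degree G x
  cut-singleton≤degree x = begin
    cut (singleton x)
      ≡⟨ ∑-at x _ ⟩
    ∑[ y ∈ E ] crossing (singleton x) x y + ∑[ z ∈ others x ] ∑[ y ∈ E ] crossing (singleton x) z y
      ≡⟨ cong (∑[ y ∈ E ] crossing (singleton x) x y +_)
           (trans (∑-cong (others x) outside) (∑-zero (others x) λ _ → refl)) ⟩
    ∑[ y ∈ E ] crossing (singleton x) x y + 0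
      ≡⟨ +-identityʳ _ ⟩
    ∑[ y ∈ E ] crossing (singleton x) x y
      ≤⟨ ∑-mono E (λ y → k*≤k (adj x y) (singleton x x) (not (singleton x y))) ⟩
    ∑[ y ∈ E ] adj x y
      ≡⟨ degree≡∑ x ⟨
    degree G x
      ∎
    where
    open ≤-Reasoning
    outside : ∀ {z} → z ∈ others x → ∑[ y ∈ E ] crossing (singleton x) z y ≡ 0
    outside {z} z∈ = ∑-zero E λ y →
      trans (cong (λ β → adj z y * (⟦ β ⟧ * ⟦ not (singleton x y) ⟧))
                  (dec-false (z ≟ x) (∈-others⁻ z∈)))
            (*-zeroʳ (adj z y))

    k*≤k : ∀ k β γ → k * (⟦ β ⟧ * ⟦ γ ⟧) ≤ k
    k*≤k k true  true  = ≤-reflexive (*-identityʳ k)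
    k*≤k k true  false = ≤-trans (≤-reflexive (*-zeroʳ k)) z≤n
    k*≤k k false γ     = ≤-trans (≤-reflexive (*-zeroʳ k)) z≤n

  ∈-edges⁺ : ∀ {x y} → Adj x y → (x , y) ∈ edges G ⊎ (y , x) ∈ edges G
  ∈-edges⁺ {x} {y} xy with ∈-pairs⁺ (complete x) (complete y) (λ { refl → irrefl refl xy })
  ... | inj₁ xy∈ = inj₁ (∈-filter⁺ (uncurry adj?) xy∈ xy)
  ... | inj₂ yx∈ = inj₂ (∈-filter⁺ (uncurry adj?) yx∈ (symm xy))

  disconnects? : Decidable λ S → ¬ Connected (G ∖ S)
  disconnects? S = ¬? (connected? (G ∖ S))

  -- `X` is constant along every walk that avoids the cut edges, so no such walk leads from a vertex
  -- of `X` to one outside.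
  cutEdges-disconnect : ∀ X → Proper {V} X → ¬ Connected (G ∖ cutEdges X)
  cutEdges-disconnect X (x , y , x∈ , y∉) connected =
    contradiction (trans (sym x∈) (trans (constant (connected x y)) y∉)) λ ()
    where
    constant : ∀ {u v} → Star (Graph.Adj (G ∖ cutEdges X)) u v → X u ≡ X v
    constant ε = refl
    constant {u} (_◅_ {j = v} (uv , uv∉ , vu∉) walk) = trans step (constant walk)
      where
      step : X u ≡ X v
      step with X u Bool.≟ X v | ∈-edges⁺ uv
      ... | yes eq | _        = eq
      ... | no u≢v | inj₁ uv∈ = contradiction (∈-filter⁺ (crosses? X) uv∈ u≢v) uv∉
      ... | no u≢v | inj₂ vu∈ = contradiction (∈-filter⁺ (crosses? X) vu∈ (u≢v ∘ sym)) vu∉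

  -- The cut edges form a sublist of `edges G` whose deletion disconnects, so their number is among
  -- the values minimised.
  edgeConnectivity≤cut : ∀ X → Proper {V} X → edgeConnectivity G ≤ cut X
  edgeConnectivity≤cut X proper =
    min≤v⁺ (length (edges G)) (map length (filter disconnects? (sublists (edges G)))) (inj₂ (lose
      (∈-map⁺ length (∈-filter⁺ disconnects?
        (filter∈sublists (crosses? X) (edges G)) (cutEdges-disconnect X proper)))
      (≤-reflexive (length-cutEdges X))))

  edgeConnectivity≤degree : 2 ≤ ∣ V ∣ → ∀ x → edgeConnectivity G ≤ degree G x
  edgeConnectivity≤degree 2≤ x =
    ≤-trans (edgeConnectivity≤cut (singleton x) (singleton-proper 2≤ x)) (cut-singleton≤degree x)

  edgeConnectivity≤minDegree : 2 ≤ ∣ V ∣ → edgeConnectivity G ≤ minDegree G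
  edgeConnectivity≤minDegree 2≤ =
    -- The default `∣ V ∣` of `minDegree` has to be bounded as well; any vertex serves, as its
    -- degree is at most `∣ V ∣`.
    v≤min⁺ (≤-trans (edgeConnectivity≤degree 2≤ (proj₁ (distinct 2≤))) (length-filter (adj? _) E))
           (All.map⁺ (All.universal (edgeConnectivity≤degree 2≤) E))

  minDegree≤degree : ∀ x → minDegree G ≤ degree G x
  minDegree≤degree x = All.lookup (min≤xs ∣ V ∣ (map (degree G) E)) (∈-map⁺ (degree G) (complete x))

  module _ (S : List (Carrier V × Carrier V)) (S⊆ : S ⊆ edges G)
           (reach? : ∀ ((x , y) : Carrier V × Carrier V) → Dec (Star (Graph.Adj (G ∖ S)) x y)) where

    component : Carrier V → Carrier V → Bool
    component x y = does (reach? (x , y))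

    component-closed : ∀ x {y z} → Graph.Adj (G ∖ S) y z → component x y ≡ component x z
    component-closed x {y} {z} yz with reach? (x , y)
    ... | yes xy = sym (dec-true (reach? (x , z)) (xy ◅◅ yz ◅ ε))
    ... | no ¬xy = sym (dec-false (reach? (x , z)) λ xz → ¬xy (xz ◅◅ Graph.symm (G ∖ S) yz ◅ ε))

    -- The two ends of an edge that survives the deletion lie in the same component, so an edge
    -- across the component must have been deleted.
    cutEdges-component⊆ : ∀ x → cutEdges (component x) ⊆ S
    cutEdges-component⊆ x {y , z} e∈ with (y , z) ∈? S
      where open DecMembership (≡-dec _≟_ _≟_) using (_∈?_)
    ... | yes yz∈S = yz∈S
    ... | no yz∉S = contradiction (component-closed x (yz , yz∉S , zy∉S)) crosses
      where
      yz∈edges : (y , z) ∈ edges G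
      yz∈edges = proj₁ (∈-filter⁻ (crosses? (component x)) {xs = edges G} e∈)

      crosses : component x y ≢ component x z
      crosses = proj₂ (∈-filter⁻ (crosses? (component x)) {xs = edges G} e∈)

      edges⇒pairs : ∀ {e} → e ∈ edges G → e ∈ pairs E × uncurry Adj e
      edges⇒pairs = ∈-filter⁻ (uncurry adj?) {xs = pairs E}

      yz : Adj y z
      yz = proj₂ (edges⇒pairs yz∈edges)

      -- The edge survives only if its reversal is missing from `S` too; `S` lies in `edges G`,
      -- which lists one orientation only.
      zy∉S : (z , y) ∉ S
      zy∉S zy∈S = pairs-asym unique (proj₁ (edges⇒pairs yz∈edges)) (proj₁ (edges⇒pairs (S⊆ zy∈S)))

    cut-component≤ : ∀ x → cut (component x) ≤ length S
    cut-component≤ x = begin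
      cut (component x)                ≡⟨ length-cutEdges (component x) ⟨
      length (cutEdges (component x))  ≤⟨ length-mono-⊆ unique′ (cutEdges-component⊆ x) ⟩
      length S                         ∎
      where
      open ≤-Reasoning
      unique′ : Unique (cutEdges (component x))
      unique′ = Unique.filter⁺ (crosses? (component x))
                               (Unique.filter⁺ (uncurry adj?) (pairs-unique unique))

  -- The double negation spares an algorithm for reachability; only inequalities
  -- between naturals, which are stable, are deduced from it.
  cut-attained : 2 ≤ ∣ V ∣ → ¬ ¬ ∃ λ X → Proper {V} X × cut X ≤ edgeConnectivity G
  cut-attained 2≤ none with argmin-sel id (length (edges G))
      (map length (filter disconnects? (sublists (edges G))))
  -- Here the minimum is its default, the number of all edges; that bounds every cut, and a
  -- singleton is a proper set.
  ... | inj₁ λ≡ = none (singleton x , singleton-proper 2≤ x , (begin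
    cut (singleton x)                ≡⟨ length-cutEdges (singleton x) ⟨
    length (cutEdges (singleton x))  ≤⟨ length-filter (crosses? (singleton x)) (edges G) ⟩
    length (edges G)                 ≡⟨ λ≡ ⟨
    edgeConnectivity G               ∎))
    where
    open ≤-Reasoning
    x = proj₁ (distinct 2≤)
  ... | inj₂ λ∈ with ∈-map∘filter⁻ length disconnects? {xs = sublists (edges G)} λ∈
  ...   | S , S∈ , λ≡ , disconnected =
    -- The goal is a contradiction, so reachability may be decided for all pairs at once. Deleting
    -- `S` disconnects, hence some pair has no walk, and the component of its first vertex is proper
    -- with a cut inside `S`.
    ¬¬-decide (Σᶠ V (λ _ → V)) (λ (x , y) → Star (Graph.Adj (G ∖ S)) x y) λ reach? →
      disconnected λ x y → case reach? (x , y) of λ where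
        (yes xy) → xy
        (no ¬xy) → ⊥-elim (none
          ( component S S⊆ reach? x
          , (x , y , dec-true (reach? (x , x)) ε , dec-false (reach? (x , y)) ¬xy)
          , ≤-trans (cut-component≤ S S⊆ reach? x) (≤-reflexive (sym λ≡))))
    where
    S⊆ : S ⊆ edges G
    S⊆ = sublist⇒⊆ (edges G) S∈

-- Divided fibres and the weighted cuts of their sizes.

record Share (n : ℕ) : Set where
  constructor share
  field
    inside  : ℕ
    outside : ℕ
    -- Keeping both counts together with their sum avoids a truncated difference.
    total   : inside + outside ≡ n

open Share

⟦β⟧+⟦¬β⟧≡1 : ∀ β → ⟦ β ⟧ + ⟦ not β ⟧ ≡ 1
⟦β⟧+⟦¬β⟧≡1 true  = refl
⟦β⟧+⟦¬β⟧≡1 false = refl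

pure : ∀ {n} → Bool → Share n
pure {n} β = share (n * ⟦ β ⟧) (n * ⟦ not β ⟧) (begin
  n * ⟦ β ⟧ + n * ⟦ not β ⟧  ≡⟨ *-distribˡ-+ n _ _ ⟨
  n * (⟦ β ⟧ + ⟦ not β ⟧)    ≡⟨ cong (n *_) (⟦β⟧+⟦¬β⟧≡1 β) ⟩
  n * 1                      ≡⟨ *-identityʳ n ⟩
  n                          ∎)
  where open ≡-Reasoning

-- A share with nothing outside counts as full, also for `n` equal to 0; with something outside, the
-- hypothesis leaves only the empty share.
unsplit⇒pure : ∀ {n} (s : Share n) → inside s ≡ 0 ⊎ outside s ≡ 0 →
               let β = does (outside s ℕ.≟ 0) in
               inside s ≡ n * ⟦ β ⟧ × outside s ≡ n * ⟦ not β ⟧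
unsplit⇒pure (share i zero    refl) _           =
  sym (trans (*-identityʳ (i + 0)) (+-identityʳ i)) , sym (*-zeroʳ (i + 0))
unsplit⇒pure (share _ (suc o) refl) (inj₁ refl) = sym (*-zeroʳ o) , sym (*-identityʳ (suc o))

module Shares {V : FiniteSet} (G : Graph V) (n : ℕ) where
  open Enumeration V
  open Cut G

  -- For the shares of a vertex set of the product this counts the edges leaving it between distinct
  -- fibres. It is defined for arbitrary shares so that they can be changed one at a time.
  cutˢ : (Carrier V → Share n) → ℕ
  cutˢ s = ∑[ x ∈ E ] ∑[ y ∈ E ] (adj x y * (inside (s x) * outside (s y)))

  -- The coefficients of `inside (s x)` and `outside (s x)` in `cutˢ s`; `remainder` is the constant
  -- term. None of the three looks at the share of `x`.
  out-weight in-weight : (Carrier V → Share n) → Carrier V → ℕ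
  out-weight s x = ∑[ y ∈ others x ] (adj x y * outside (s y))
  in-weight  s x = ∑[ y ∈ others x ] (adj x y * inside (s y))

  remainder : (Carrier V → Share n) → Carrier V → ℕ
  remainder s x = ∑[ y ∈ others x ] ∑[ z ∈ others x ] (adj y z * (inside (s y) * outside (s z)))

  -- The row and the column of `x` are split off the double sum. Their common entry vanishes since
  -- `x` is not adjacent to itself, and symmetry turns the column into `in-weight`.
  cutˢ-at : ∀ s x → cutˢ s ≡
            inside (s x) * out-weight s x + (outside (s x) * in-weight s x + remainder s x)
  cutˢ-at s x = begin
    cutˢ s
      ≡⟨ ∑-at x _ ⟩
    ∑ E (t x) + ∑[ y ∈ others x ] ∑ E (t y)
      ≡⟨ cong₂ _+_ (∑-at x (t x)) (trans (∑-cong (others x) λ {y} _ → ∑-at x (t y)) (∑-+ (others x) _ _)) ⟩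
    (t x x + ∑ (others x) (t x)) + (∑[ y ∈ others x ] t y x + remainder s x)
      ≡⟨ cong₂ _+_ (cong₂ _+_ diagonal leaving) (cong (_+ remainder s x) entering) ⟩
    inside (s x) * out-weight s x + (outside (s x) * in-weight s x + remainder s x)
      ∎
    where
    open ≡-Reasoning
    t = λ y z → adj y z * (inside (s y) * outside (s z))

    diagonal : t x x ≡ 0
    diagonal = cong (_* (inside (s x) * outside (s x))) (adj-irrefl x)

    leaving : ∑ (others x) (t x) ≡ inside (s x) * out-weight s x
    leaving = trans (∑-cong (others x) λ {y} _ → regroup (adj x y) (inside (s x)) (outside (s y)))
                    (∑-*ˡ (others x) (inside (s x)) _)
      where
      regroup : ∀ k l m → k * (l * m) ≡ l * (k * m)
      regroup = solve-∀

    entering : ∑[ y ∈ others x ] t y x ≡ outside (s x) * in-weight s x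
    entering = trans (∑-cong (others x) λ {y} _ →
                       trans (cong (_* (inside (s y) * outside (s x))) (adj-sym y x))
                             (regroup (adj x y) (inside (s y)) (outside (s x))))
                     (∑-*ˡ (others x) (outside (s x)) _)
      where
      regroup : ∀ k l m → k * (l * m) ≡ m * (k * l)
      regroup = solve-∀

  _[_≔_] : (Carrier V → A) → Carrier V → A → Carrier V → A
  (s [ x ≔ t ]) y = if does (y ≟ x) then t else s y

  updated : ∀ (s : Carrier V → A) x t → (s [ x ≔ t ]) x ≡ t
  updated s x t = cong (if_then t else s x) (dec-true (x ≟ x) refl)

  unchanged : ∀ (s : Carrier V → A) {x y} t → y ≢ x → (s [ x ≔ t ]) y ≡ s y
  unchanged s {x} {y} t y≢x = cong (if_then t else s y) (dec-false (y ≟ x) y≢x)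

  -- The coefficients and the constant term involve only vertices other than `x`, where the update
  -- changes nothing.
  cutˢ-update : ∀ s x t → cutˢ (s [ x ≔ t ]) ≡
                inside t * out-weight s x + (outside t * in-weight s x + remainder s x)
  cutˢ-update s x t = trans (cutˢ-at s′ x) (cong₂ _+_
    (cong₂ _*_ (cong inside (updated s x t))
      (∑-cong (others x) λ {y} y∈ → cong (λ u → adj x y * outside u) (same y∈)))
    (cong₂ _+_
      (cong₂ _*_ (cong outside (updated s x t))
        (∑-cong (others x) λ {y} y∈ → cong (λ u → adj x y * inside u) (same y∈)))
      (∑-cong (others x) λ {y} y∈ → ∑-cong (others x) λ {z} z∈ →
        cong₂ (λ u v → adj y z * (inside u * outside v)) (same y∈) (same z∈))))
    where
    s′ = s [ x ≔ t ]

    same : ∀ {y} → y ∈ others x → s′ y ≡ s y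
    same y∈ = unchanged s t (∈-others⁻ y∈)

  -- cutˢ is affine in each single share, hence minimised at a pure one.
  round-at : ∀ s x → ∃ λ β → cutˢ (s [ x ≔ pure β ]) ≤ cutˢ s
  round-at s x with ≤-total (out-weight s x) (in-weight s x)
  -- All `n` vertices go to the side with the smaller coefficient. Writing `n` as `i + o` turns the
  -- comparison into a polynomial identity and one monotone step.
  ... | inj₁ c≤d = true , (begin
    cutˢ (s [ x ≔ pure true ])                 ≡⟨ cutˢ-update s x (pure true) ⟩
    n * 1 * c + (n * 0 * d + r)                ≡⟨ cong (λ m → m * 1 * c + (m * 0 * d + r)) (total (s x)) ⟨
    (i + o) * 1 * c + ((i + o) * 0 * d + r)    ≡⟨ expand i o c d r ⟩
    i * c + (o * c + r)                        ≤⟨ +-monoʳ-≤ (i * c) (+-monoˡ-≤ r (*-monoʳ-≤ o c≤d)) ⟩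
    i * c + (o * d + r)                        ≡⟨ cutˢ-at s x ⟨
    cutˢ s                                     ∎)
    where
    open ≤-Reasoning
    c = out-weight s x
    d = in-weight s x
    r = remainder s x
    i = inside (s x)
    o = outside (s x)
    expand : ∀ i o c d r → (i + o) * 1 * c + ((i + o) * 0 * d + r) ≡ i * c + (o * c + r)
    expand = solve-∀
  ... | inj₂ d≤c = false , (begin
    cutˢ (s [ x ≔ pure false ])                ≡⟨ cutˢ-update s x (pure false) ⟩
    n * 0 * c + (n * 1 * d + r)                ≡⟨ cong (λ m → m * 0 * c + (m * 1 * d + r)) (total (s x)) ⟨
    (i + o) * 0 * c + ((i + o) * 1 * d + r)    ≡⟨ expand i o c d r ⟩
    i * d + (o * d + r)                        ≤⟨ +-monoˡ-≤ (o * d + r) (*-monoʳ-≤ i d≤c) ⟩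
    i * c + (o * d + r)                        ≡⟨ cutˢ-at s x ⟨
    cutˢ s                                     ∎)
    where
    open ≤-Reasoning
    c = out-weight s x
    d = in-weight s x
    r = remainder s x
    i = inside (s x)
    o = outside (s x)
    expand : ∀ i o c d r → (i + o) * 0 * c + ((i + o) * 1 * d + r) ≡ i * d + (o * d + r)
    expand = solve-∀

  -- Rounds one vertex after another, never increasing `cutˢ`. That shares off `xs` are kept allows
  -- a chosen split fibre to be spared.
  round : ∀ xs s → ∃₂ λ s′ (X : Carrier V → Bool) →
          (∀ {x} → x ∈ xs → s′ x ≡ pure (X x)) × (∀ {x} → x ∉ xs → s′ x ≡ s x) × cutˢ s′ ≤ cutˢ s
  round []       s = s , (λ _ → true) , (λ ()) , (λ _ → refl) , ≤-refl
  round (x ∷ xs) s with round xs s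
  ... | s₁ , X , rounded , kept , s₁≤s with round-at s₁ x
  ...   | β , s₂≤s₁ = s₁ [ x ≔ pure β ] , X [ x ≔ β ] , rounded′ , kept′ , ≤-trans s₂≤s₁ s₁≤s
    where
    rounded′ : ∀ {y} → y ∈ x ∷ xs → (s₁ [ x ≔ pure β ]) y ≡ pure ((X [ x ≔ β ]) y)
    rounded′ {y} y∈ with y ≟ x | y∈
    ... | yes _  | _         = refl
    ... | no y≢x | here y≡x  = contradiction y≡x y≢x
    ... | no _   | there y∈′ = rounded y∈′

    kept′ : ∀ {y} → y ∉ x ∷ xs → (s₁ [ x ≔ pure β ]) y ≡ s y
    kept′ y∉ = trans (unchanged s₁ (pure β) (y∉ ∘ here)) (kept (y∉ ∘ there))

  Pure : (Carrier V → Share n) → (Carrier V → Bool) → Set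
  Pure s X = ∀ x → inside (s x) ≡ n * ⟦ X x ⟧ × outside (s x) ≡ n * ⟦ not (X x) ⟧

  -- Between a full and an empty fibre, each edge of the cut in `G` is blown up to `n ^ 2` edges.
  cutˢ-pure : ∀ s X → Pure s X → cutˢ s ≡ cut X * n ^ 2
  cutˢ-pure s X pure-s = begin
    ∑[ x ∈ E ] ∑[ y ∈ E ] (adj x y * (inside (s x) * outside (s y)))
      ≡⟨ ∑-cong E (λ {x} _ → ∑-cong E λ {y} _ → scale x y) ⟩
    ∑[ x ∈ E ] ∑[ y ∈ E ] (crossing X x y * n ^ 2)
      ≡⟨ ∑-cong E (λ {x} _ → ∑-*ʳ E (n ^ 2) (crossing X x)) ⟩
    ∑[ x ∈ E ] (∑[ y ∈ E ] crossing X x y * n ^ 2)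
      ≡⟨ ∑-*ʳ E (n ^ 2) _ ⟩
    cut X * n ^ 2
      ∎
    where
    open ≡-Reasoning
    regroup : ∀ k n β γ → k * (n * β * (n * γ)) ≡ k * (β * γ) * (n * (n * 1))
    regroup = solve-∀

    scale : ∀ x y → adj x y * (inside (s x) * outside (s y)) ≡ crossing X x y * n ^ 2
    scale x y = trans
      (cong (adj x y *_) (cong₂ _*_ (proj₁ (pure-s x)) (proj₂ (pure-s y))))
      (regroup (adj x y) n ⟦ X x ⟧ ⟦ not (X y) ⟧)

  edgeConnectivity≤cutˢ : ∀ s X → Pure s X → Proper {V} X → edgeConnectivity G * n ^ 2 ≤ cutˢ s
  edgeConnectivity≤cutˢ s X pure-s proper = begin
    edgeConnectivity G * n ^ 2  ≤⟨ *-monoˡ-≤ (n ^ 2) (edgeConnectivity≤cut X proper) ⟩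
    cut X * n ^ 2               ≡⟨ cutˢ-pure s X pure-s ⟨
    cutˢ s                      ∎
    where open ≤-Reasoning

  -- Every share but that of x is rounded first.  If the others are not all
  -- rounded alike, rounding x as well leaves a proper cut of G; otherwise
  -- the others lie wholly on one side, and every edge at x meets the cut there.
  cutˢ-bounds : 2 ≤ ∣ V ∣ → ∀ s x →
    edgeConnectivity G * n ^ 2 ≤ cutˢ s ⊎
    degree G x * n * inside (s x) ≤ cutˢ s ⊎
    degree G x * n * outside (s x) ≤ cutˢ s
  -- `b` is a reference vertex: the others are rounded alike iff they all agree with it.
  cutˢ-bounds 2≤ s x with another 2≤ x | round (others x) s
  ... | b , b≢x | s₁ , X , rounded , kept , s₁≤s
    with All.all? (λ y → X y Bool.≟ X b) (others x)
  ...   | yes constant = inj₂ (alike (X b) refl)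
    where
    open ≤-Reasoning
    s₁x≡sx : s₁ x ≡ s x
    s₁x≡sx = kept λ x∈ → ∈-others⁻ x∈ refl

    value : ∀ {β y} → X b ≡ β → y ∈ others x → s₁ y ≡ pure β
    value Xb≡β y∈ = trans (rounded y∈) (cong pure (trans (All.lookup constant y∈) Xb≡β))

    weight : ∑[ y ∈ others x ] (adj x y * (n * 1)) ≡ degree G x * n
    weight = begin-equality
      ∑[ y ∈ others x ] (adj x y * (n * 1))  ≡⟨ ∑-*ʳ (others x) (n * 1) (adj x) ⟩
      ∑ (others x) (adj x) * (n * 1)         ≡⟨ cong₂ _*_ (degree≡∑-others x) (sym (*-identityʳ n)) ⟨
      degree G x * n                         ∎

    out-weight≡ : X b ≡ false → out-weight s₁ x ≡ degree G x * n
    out-weight≡ Xb = trans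
      (∑-cong (others x) λ {y} y∈ → cong (λ u → adj x y * outside u) (value Xb y∈)) weight

    in-weight≡ : X b ≡ true → in-weight s₁ x ≡ degree G x * n
    in-weight≡ Xb = trans
      (∑-cong (others x) λ {y} y∈ → cong (λ u → adj x y * inside u) (value Xb y∈)) weight

    leaving  = inside (s₁ x) * out-weight s₁ x
    entering = outside (s₁ x) * in-weight s₁ x

    alike : ∀ β → X b ≡ β → degree G x * n * inside (s x) ≤ cutˢ s ⊎
                            degree G x * n * outside (s x) ≤ cutˢ s
    alike false Xb = inj₁ (begin
      degree G x * n * inside (s x)              ≡⟨ *-comm (degree G x * n) _ ⟩
      inside (s x) * (degree G x * n)            ≡⟨ cong₂ _*_ (cong inside s₁x≡sx) (out-weight≡ Xb) ⟨
      leaving                                    ≤⟨ m≤m+n leaving _ ⟩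
      leaving + (entering + remainder s₁ x)      ≡⟨ cutˢ-at s₁ x ⟨
      cutˢ s₁                                    ≤⟨ s₁≤s ⟩
      cutˢ s                                     ∎)
    alike true Xb = inj₂ (begin
      degree G x * n * outside (s x)             ≡⟨ *-comm (degree G x * n) _ ⟩
      outside (s x) * (degree G x * n)           ≡⟨ cong₂ _*_ (cong outside s₁x≡sx) (in-weight≡ Xb) ⟨
      entering                                   ≤⟨ m≤m+n entering (remainder s₁ x) ⟩
      entering + remainder s₁ x                  ≤⟨ m≤n+m _ leaving ⟩
      leaving + (entering + remainder s₁ x)      ≡⟨ cutˢ-at s₁ x ⟨
      cutˢ s₁                                    ≤⟨ s₁≤s ⟩
      cutˢ s                                     ∎)
  ...   | no ¬constant
    with find (All.¬All⇒Any¬ (λ y → X y Bool.≟ X b) (others x) ¬constant) | round-at s₁ x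
  ...     | c , c∈ , Xc≢Xb | β , s₂≤s₁ =
    inj₁ (≤-trans (edgeConnectivity≤cutˢ (s₁ [ x ≔ pure β ]) X₂ pure₂ proper) (≤-trans s₂≤s₁ s₁≤s))
    where
    X₂ = X [ x ≔ β ]

    pure₂ : Pure (s₁ [ x ≔ pure β ]) X₂
    pure₂ y with y ≟ x
    ... | yes _  = refl , refl
    ... | no y≢x = cong inside (rounded (∈-others⁺ y≢x)) , cong outside (rounded (∈-others⁺ y≢x))

    -- `b` and `c` lie on different sides, and neither is `x`, so rounding at `x` leaves them apart.
    proper : Proper {V} X₂
    proper = ≢⇒proper {V} X₂ λ X₂c≡X₂b → Xc≢Xb (begin
      X c   ≡⟨ unchanged X β (∈-others⁻ c∈) ⟨
      X₂ c  ≡⟨ X₂c≡X₂b ⟩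
      X₂ b  ≡⟨ unchanged X β b≢x ⟩
      X b   ∎)
      where open ≡-Reasoning

-- Positive sums and degrees.

∑-positive : ∀ (xs : List A) (X : A → Bool) → ∑[ x ∈ xs ] ⟦ X x ⟧ ≢ 0 → ∃ λ x → X x ≡ true
∑-positive []       X ≢0 = contradiction refl ≢0
∑-positive (x ∷ xs) X ≢0 with X x in eq
... | true  = x , eq
... | false = ∑-positive xs X ≢0

-- A walk from `x` to some other vertex has a first edge.
degree-positive : ∀ {V : FiniteSet} (G : Graph V) → 2 ≤ ∣ V ∣ → Connected G → ∀ x → 1 ≤ degree G x
degree-positive {V} G 2≤ connected x with another 2≤ x
  where open Enumeration V
... | y , y≢x with connected x y
...   | ε      = contradiction refl y≢x
...   | xz ◅ _ = begin
  1            ≡⟨ cong ⟦_⟧ (dec-true (Graph.adj? G x _) xz) ⟨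
  adj x _      ≤⟨ term≤∑ _ (adj x) ⟩
  ∑ E (adj x)  ≡⟨ degree≡∑ x ⟨
  degree G x   ∎
  where
  open ≤-Reasoning
  open Enumeration V
  open Cut G

-- Sums over the vertex set of the product.

∑-Σᶠ : ∀ (U : FiniteSet) (W : Carrier U → FiniteSet) f →
       ∑ (FiniteSet.elements (Σᶠ U W)) f ≡
       ∑[ a ∈ FiniteSet.elements U ] ∑[ x ∈ FiniteSet.elements (W a) ] f (a , x)
∑-Σᶠ U W f = trans (∑-concatMap (λ a → map (a ,_) (FiniteSet.elements (W a))) (FiniteSet.elements U) f)
  (∑-cong (FiniteSet.elements U) λ {a} _ → ∑-map (a ,_) (FiniteSet.elements (W a)) f)

length-Σᶠ : ∀ (U V : FiniteSet) → ∣ Σᶠ U (λ _ → V) ∣ ≡ ∣ U ∣ * ∣ V ∣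
length-Σᶠ U V = begin
  ∣ Σᶠ U (λ _ → V) ∣  ≡⟨ ∑-1 (FiniteSet.elements (Σᶠ U (λ _ → V))) ⟨
  ∑[ p ∈ FiniteSet.elements (Σᶠ U (λ _ → V)) ] 1  ≡⟨ ∑-Σᶠ U (λ _ → V) (λ _ → 1) ⟩
  ∑[ a ∈ FiniteSet.elements U ] ∑[ x ∈ FiniteSet.elements V ] 1  ≡⟨ ∑-const (FiniteSet.elements U) _ ⟩
  ∣ U ∣ * ∑[ x ∈ FiniteSet.elements V ] 1  ≡⟨ cong (∣ U ∣ *_) (∑-1 (FiniteSet.elements V)) ⟩
  ∣ U ∣ * ∣ V ∣ ∎
  where open ≡-Reasoning

-- Degrees, cuts and edge-connectivity of the product.

module Product {i} {U V : FiniteSet} (G : Graph U) {I : Set i}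
               (Γ : I → Graph V) (h : Carrier U → I) where
  private
    module U = Enumeration U
    module V = Enumeration V
    module UV = Enumeration (Σᶠ U λ _ → V)
    module G = Cut G
    module F a = Cut (Γ (h a))

  n : ℕ
  n = ∣ V ∣

  H : Graph (Σᶠ U λ _ → V)
  H = G ∘⟨ h ⟩ Γ

  module H = Cut H
  open Shares G n

  -- The two kinds of adjacency exclude each other because `G` has no loops, so their indicators add
  -- up.
  adj-product : ∀ a x b y → H.adj (a , x) (b , y) ≡ G.adj a b + ⟦ does (b U.≟ a) ⟧ * F.adj a x y
  adj-product a x b y with b U.≟ a
  ... | no b≢a = trans (cong ⟦_⟧ same) (sym (+-identityʳ _))
    where
    same : does (Graph.adj? H (a , x) (b , y)) ≡ does (Graph.adj? G a b)
    same = does-⇔ (mk⇔ (λ { (between ab) → ab ; (within _) → contradiction refl b≢a }) between)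
                  (Graph.adj? H (a , x) (b , y)) (Graph.adj? G a b)
  ... | yes refl = begin
    H.adj (a , x) (a , y)          ≡⟨ cong ⟦_⟧ same ⟩
    F.adj a x y                    ≡⟨ +-identityʳ _ ⟨
    1 * F.adj a x y                ≡⟨ cong (_+ 1 * F.adj a x y) (G.adj-irrefl a) ⟨
    G.adj a a + 1 * F.adj a x y    ∎
    where
    open ≡-Reasoning
    same : does (Graph.adj? H (a , x) (a , y)) ≡ does (Graph.adj? (Γ (h a)) x y)
    same = does-⇔ (mk⇔ (λ { (between aa) → contradiction aa (Graph.irrefl G refl)
                         ; (within xy)  → xy }) within)
                  (Graph.adj? H (a , x) (a , y)) (Graph.adj? (Γ (h a)) x y)

  -- The weight `w` is left free: the constant 1 gives degrees, the indicator of the complement of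
  -- `X` gives cuts.
  ∑-adj-product : ∀ a x (w : Carrier U × Carrier V → ℕ) →
    ∑[ q ∈ UV.E ] (H.adj (a , x) q * w q) ≡
    ∑[ b ∈ U.E ] (G.adj a b * ∑[ y ∈ V.E ] w (b , y)) + ∑[ y ∈ V.E ] (F.adj a x y * w (a , y))
  ∑-adj-product a x w = begin
    ∑[ q ∈ UV.E ] (H.adj (a , x) q * w q)
      ≡⟨ ∑-Σᶠ U (λ _ → V) _ ⟩
    ∑[ b ∈ U.E ] ∑[ y ∈ V.E ] (H.adj (a , x) (b , y) * w (b , y))
      ≡⟨ ∑-cong U.E (λ {b} _ → row b) ⟩
    ∑[ b ∈ U.E ] (G.adj a b * ∑[ y ∈ V.E ] w (b , y) + δ b * W b)
      ≡⟨ ∑-+ U.E _ _ ⟩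
    ∑[ b ∈ U.E ] (G.adj a b * ∑[ y ∈ V.E ] w (b , y)) + ∑[ b ∈ U.E ] (δ b * W b)
      ≡⟨ cong (∑[ b ∈ U.E ] (G.adj a b * ∑[ y ∈ V.E ] w (b , y)) +_) diagonal ⟩
    ∑[ b ∈ U.E ] (G.adj a b * ∑[ y ∈ V.E ] w (b , y)) + W a
      ∎
    where
    open ≡-Reasoning
    δ = λ b → ⟦ does (b U.≟ a) ⟧
    -- `W b` uses the graph of the fibre over `a` for every `b`, which makes sense as all fibres
    -- share the vertex set `V`; the factor `δ b` then keeps only the term at `a`.
    W = λ b → ∑[ y ∈ V.E ] (F.adj a x y * w (b , y))

    distribute : ∀ k d f m → (k + d * f) * m ≡ k * m + d * (f * m)
    distribute = solve-∀

    row : ∀ b → ∑[ y ∈ V.E ] (H.adj (a , x) (b , y) * w (b , y)) ≡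
                G.adj a b * ∑[ y ∈ V.E ] w (b , y) + δ b * W b
    row b = begin
      ∑[ y ∈ V.E ] (H.adj (a , x) (b , y) * w (b , y))
        ≡⟨ ∑-cong V.E (λ {y} _ → trans (cong (_* w (b , y)) (adj-product a x b y))
                                       (distribute (G.adj a b) (δ b) (F.adj a x y) (w (b , y)))) ⟩
      ∑[ y ∈ V.E ] (G.adj a b * w (b , y) + δ b * (F.adj a x y * w (b , y)))
        ≡⟨ ∑-+ V.E _ _ ⟩
      ∑[ y ∈ V.E ] (G.adj a b * w (b , y)) + ∑[ y ∈ V.E ] (δ b * (F.adj a x y * w (b , y)))
        ≡⟨ cong₂ _+_ (∑-*ˡ V.E (G.adj a b) _) (∑-*ˡ V.E (δ b) _) ⟩
      G.adj a b * ∑[ y ∈ V.E ] w (b , y) + δ b * W b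
        ∎

    diagonal : ∑[ b ∈ U.E ] (δ b * W b) ≡ W a
    diagonal = begin
      ∑[ b ∈ U.E ] (δ b * W b)
        ≡⟨ U.∑-at a _ ⟩
      δ a * W a + ∑[ b ∈ U.others a ] (δ b * W b)
        ≡⟨ cong₂ _+_ (cong (λ β → ⟦ β ⟧ * W a) (dec-true (a U.≟ a) refl))
             (trans (∑-cong (U.others a) λ {b} b∈ →
                       cong (λ β → ⟦ β ⟧ * W b) (dec-false (b U.≟ a) (U.∈-others⁻ b∈)))
                    (∑-zero (U.others a) λ _ → refl)) ⟩
      1 * W a + 0
        ≡⟨ trans (+-identityʳ _) (+-identityʳ _) ⟩
      W a
        ∎

  degree-product : ∀ a x → degree H (a , x) ≡ degree G a * n + degree (Γ (h a)) x
  degree-product a x = begin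
    degree H (a , x)
      ≡⟨ H.degree≡∑ (a , x) ⟩
    ∑[ q ∈ UV.E ] H.adj (a , x) q
      ≡⟨ ∑-cong UV.E (λ _ → sym (*-identityʳ _)) ⟩
    ∑[ q ∈ UV.E ] (H.adj (a , x) q * 1)
      ≡⟨ ∑-adj-product a x (λ _ → 1) ⟩
    ∑[ b ∈ U.E ] (G.adj a b * ∑[ y ∈ V.E ] 1) + ∑[ y ∈ V.E ] (F.adj a x y * 1)
      ≡⟨ cong₂ _+_
           (trans (∑-*ʳ U.E _ (G.adj a)) (cong₂ _*_ (sym (G.degree≡∑ a)) (∑-1 V.E)))
           (trans (∑-cong V.E λ _ → *-identityʳ _) (sym (F.degree≡∑ a x))) ⟩
    degree G a * n + degree (Γ (h a)) x
      ∎
    where open ≡-Reasoning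

  module _ (X : Carrier U × Carrier V → Bool) where

    fibre : Carrier U → Carrier V → Bool
    fibre a x = X (a , x)

    shares : Carrier U → Share n
    shares a = share (∑[ x ∈ V.E ] ⟦ fibre a x ⟧) (∑[ x ∈ V.E ] ⟦ not (fibre a x) ⟧) (begin
      ∑[ x ∈ V.E ] ⟦ fibre a x ⟧ + ∑[ x ∈ V.E ] ⟦ not (fibre a x) ⟧  ≡⟨ ∑-+ V.E _ _ ⟨
      ∑[ x ∈ V.E ] (⟦ fibre a x ⟧ + ⟦ not (fibre a x) ⟧)             ≡⟨ ∑-cong V.E (λ {x} _ → ⟦β⟧+⟦¬β⟧≡1 (fibre a x)) ⟩
      ∑[ x ∈ V.E ] 1                                                 ≡⟨ ∑-1 V.E ⟩
      n                                                              ∎)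
      where open ≡-Reasoning

    unsplit? : Decidable λ a → inside (shares a) ≡ 0 ⊎ outside (shares a) ≡ 0
    unsplit? a = (inside (shares a) ℕ.≟ 0) ⊎-dec (outside (shares a) ℕ.≟ 0)

    inside-positive : ∀ {a x} → X (a , x) ≡ true → 1 ≤ inside (shares a)
    inside-positive {a} {x} eq =
      ≤-trans (≤-reflexive (sym (cong ⟦_⟧ eq))) (V.term≤∑ x (λ x → ⟦ fibre a x ⟧))

    outside-positive : ∀ {a x} → X (a , x) ≡ false → 1 ≤ outside (shares a)
    outside-positive {a} {x} eq =
      ≤-trans (≤-reflexive (sym (cong (⟦_⟧ ∘ not) eq))) (V.term≤∑ x (λ x → ⟦ not (fibre a x) ⟧))

    -- The number of edges from a vertex of `X` over `a` to vertices outside `X` in other fibres is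
    -- `leaving a`, the same for all of them. Summing over the fibre therefore multiplies it by
    -- `inside (shares a)`, and the edges within the fibre remain.
    cut-product : H.cut X ≡ cutˢ shares + ∑[ a ∈ U.E ] F.cut a (fibre a)
    cut-product = begin
      H.cut X
        ≡⟨ ∑-Σᶠ U (λ _ → V) _ ⟩
      ∑[ a ∈ U.E ] ∑[ x ∈ V.E ] ∑[ q ∈ UV.E ] H.crossing X (a , x) q
        ≡⟨ ∑-cong U.E (λ {a} _ → trans (∑-cong V.E λ {x} _ → vertex a x) (∑-+ V.E _ _)) ⟩
      ∑[ a ∈ U.E ] (∑[ x ∈ V.E ] (⟦ X (a , x) ⟧ * leaving a) + F.cut a (fibre a))
        ≡⟨ ∑-+ U.E _ _ ⟩
      ∑[ a ∈ U.E ] ∑[ x ∈ V.E ] (⟦ X (a , x) ⟧ * leaving a) + ∑[ a ∈ U.E ] F.cut a (fibre a)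
        ≡⟨ cong (_+ ∑[ a ∈ U.E ] F.cut a (fibre a)) (∑-cong U.E λ {a} _ → gather a) ⟩
      cutˢ shares + ∑[ a ∈ U.E ] F.cut a (fibre a)
        ∎
      where
      open ≡-Reasoning
      regroup : ∀ k l m → k * (l * m) ≡ l * (k * m)
      regroup = solve-∀

      leaving : Carrier U → ℕ
      leaving a = ∑[ b ∈ U.E ] (G.adj a b * outside (shares b))

      vertex : ∀ a x → ∑[ q ∈ UV.E ] H.crossing X (a , x) q ≡
               ⟦ X (a , x) ⟧ * leaving a + ∑[ y ∈ V.E ] F.crossing a (fibre a) x y
      vertex a x = begin
        ∑[ q ∈ UV.E ] H.crossing X (a , x) q
          ≡⟨ ∑-cong UV.E (λ {q} _ → regroup (H.adj (a , x) q) ⟦ X (a , x) ⟧ ⟦ not (X q) ⟧) ⟩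
        ∑[ q ∈ UV.E ] (⟦ X (a , x) ⟧ * (H.adj (a , x) q * ⟦ not (X q) ⟧))
          ≡⟨ ∑-*ˡ UV.E ⟦ X (a , x) ⟧ _ ⟩
        ⟦ X (a , x) ⟧ * ∑[ q ∈ UV.E ] (H.adj (a , x) q * ⟦ not (X q) ⟧)
          ≡⟨ cong (⟦ X (a , x) ⟧ *_) (∑-adj-product a x (λ q → ⟦ not (X q) ⟧)) ⟩
        ⟦ X (a , x) ⟧ * (leaving a + ∑[ y ∈ V.E ] (F.adj a x y * ⟦ not (X (a , y)) ⟧))
          ≡⟨ *-distribˡ-+ ⟦ X (a , x) ⟧ (leaving a) _ ⟩
        ⟦ X (a , x) ⟧ * leaving a + ⟦ X (a , x) ⟧ * ∑[ y ∈ V.E ] (F.adj a x y * ⟦ not (X (a , y)) ⟧)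
          ≡⟨ cong (⟦ X (a , x) ⟧ * leaving a +_) (trans (sym (∑-*ˡ V.E ⟦ X (a , x) ⟧ _))
               (∑-cong V.E λ {y} _ → regroup ⟦ X (a , x) ⟧ (F.adj a x y) ⟦ not (X (a , y)) ⟧)) ⟩
        ⟦ X (a , x) ⟧ * leaving a + ∑[ y ∈ V.E ] F.crossing a (fibre a) x y
          ∎

      gather : ∀ a → ∑[ x ∈ V.E ] (⟦ X (a , x) ⟧ * leaving a) ≡
                     ∑[ b ∈ U.E ] (G.adj a b * (inside (shares a) * outside (shares b)))
      gather a = begin
        ∑[ x ∈ V.E ] (⟦ X (a , x) ⟧ * leaving a)
          ≡⟨ ∑-*ʳ V.E (leaving a) _ ⟩
        inside (shares a) * leaving a
          ≡⟨ ∑-*ˡ U.E (inside (shares a)) _ ⟨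
        ∑[ b ∈ U.E ] (inside (shares a) * (G.adj a b * outside (shares b)))
          ≡⟨ ∑-cong U.E (λ {b} _ → regroup (inside (shares a)) (G.adj a b) (outside (shares b))) ⟩
        ∑[ b ∈ U.E ] (G.adj a b * (inside (shares a) * outside (shares b)))
          ∎

    cutˢ≤cut : cutˢ shares ≤ H.cut X
    cutˢ≤cut = ≤-trans (m≤m+n (cutˢ shares) _) (≤-reflexive (sym cut-product))

    cutˢ+fibre≤cut : ∀ a → cutˢ shares + F.cut a (fibre a) ≤ H.cut X
    cutˢ+fibre≤cut a = begin
      cutˢ shares + F.cut a (fibre a)                ≤⟨ +-monoʳ-≤ (cutˢ shares) (U.term≤∑ a λ a → F.cut a (fibre a)) ⟩
      cutˢ shares + ∑[ a ∈ U.E ] F.cut a (fibre a)   ≡⟨ cut-product ⟨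
      H.cut X                                        ∎
      where open ≤-Reasoning

  -- A minimising set of `G` is lifted to the union of its fibres. No fibre is split, so no edge
  -- within a fibre is cut and `cutˢ-pure` gives the size.
  edgeConnectivity≤lifted : 2 ≤ ∣ U ∣ → 2 ≤ n → edgeConnectivity H ≤ edgeConnectivity G * n ^ 2
  edgeConnectivity≤lifted 2≤U 2≤n = decidable-stable (_ ≤? _) λ ≰ →
    G.cut-attained 2≤U λ (A , (a , b , a∈ , b∉) , cut≤) → ≰ (begin
      edgeConnectivity H          ≤⟨ H.edgeConnectivity≤cut (A ∘ proj₁) ((a , x₀) , (b , x₀) , a∈ , b∉) ⟩
      H.cut (A ∘ proj₁)           ≡⟨ lift A ⟩
      G.cut A * n ^ 2             ≤⟨ *-monoˡ-≤ (n ^ 2) cut≤ ⟩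
      edgeConnectivity G * n ^ 2  ∎)
    where
    open ≤-Reasoning
    -- Its copies over `a` and `b` witness that the lifted set is proper.
    x₀ = proj₁ (V.distinct 2≤n)

    clash : ∀ k β → k * (⟦ β ⟧ * ⟦ not β ⟧) ≡ 0
    clash k true  = *-zeroʳ k
    clash k false = *-zeroʳ k

    lift : ∀ A → H.cut (A ∘ proj₁) ≡ G.cut A * n ^ 2
    lift A = begin-equality
      H.cut (A ∘ proj₁)
        ≡⟨ cut-product (A ∘ proj₁) ⟩
      cutˢ (shares (A ∘ proj₁)) + ∑[ a ∈ U.E ] F.cut a (λ _ → A a)
        ≡⟨ cong₂ _+_ (cutˢ-pure (shares (A ∘ proj₁)) A λ a → ∑-const V.E _ , ∑-const V.E _)
             (∑-zero U.E λ a → ∑-zero V.E λ x → ∑-zero V.E λ y → clash (F.adj a x y) (A a)) ⟩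
      G.cut A * n ^ 2 + 0
        ≡⟨ +-identityʳ _ ⟩
      G.cut A * n ^ 2
        ∎

  -- `Y` stands for the fibre of `X` over `c` or its complement, so one argument covers both. A
  -- vertex of `Y` has `D` neighbours in other fibres and at most `F.cut c Y + k − 1` in its own,
  -- and `D + k − 1` is at most `D * k`.
  vertex-bound : 2 ≤ ∣ U ∣ → Connected G → 1 ≤ n → ∀ X c Y → ∑[ z ∈ V.E ] ⟦ Y z ⟧ ≢ 0 →
                 degree G c * n * ∑[ z ∈ V.E ] ⟦ Y z ⟧ ≤ cutˢ (shares X) →
                 F.cut c Y ≤ F.cut c (fibre X c) → minDegree H ≤ H.cut X
  vertex-bound 2≤U connected 1≤n X c Y k≢0 Dk≤ cut≤ with ∑-positive V.E Y k≢0
  -- Both sides are raised by one to absorb the `− 1`.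
  ... | z , z∈Y = ≤-pred (begin
    suc (minDegree H)
      ≤⟨ s≤s (H.minDegree≤degree (c , z)) ⟩
    suc (degree H (c , z))
      ≡⟨ cong suc (degree-product c z) ⟩
    suc (D + degree (Γ (h c)) z)
      ≡⟨ +-suc D _ ⟨
    D + suc (degree (Γ (h c)) z)
      ≤⟨ +-monoʳ-≤ D (F.degree<cut+size c Y z∈Y) ⟩
    D + (F.cut c Y + k)
      ≡⟨ regroup D (F.cut c Y) k ⟩
    (D + k) + F.cut c Y
      ≤⟨ +-monoˡ-≤ (F.cut c Y) (sum≤product D k 1≤D (n≢0⇒n>0 k≢0)) ⟩
    suc (D * k + F.cut c Y)
      ≤⟨ s≤s (+-mono-≤ Dk≤ cut≤) ⟩
    suc (cutˢ (shares X) + F.cut c (fibre X c))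
      ≤⟨ s≤s (cutˢ+fibre≤cut X c) ⟩
    suc (H.cut X)
      ∎)
    where
    open ≤-Reasoning
    D = degree G c * n
    k = ∑[ z ∈ V.E ] ⟦ Y z ⟧

    1≤D : 1 ≤ D
    1≤D = *-mono-≤ (degree-positive G 2≤U connected c) 1≤n

    regroup : ∀ D c k → D + (c + k) ≡ (D + k) + c
    regroup = solve-∀

    -- In terms of the predecessors matched below, the two sides differ by exactly `D * k`.
    sum≤product : ∀ D k → 1 ≤ D → 1 ≤ k → D + k ≤ suc (D * k)
    sum≤product (suc D) (suc k) _ _ = ≤-trans (m≤m+n _ (D * k)) (≤-reflexive (expand D k))
      where
      expand : ∀ D k → suc D + suc k + D * k ≡ suc (suc D * suc k)
      expand = solve-∀

  lower-bound : 2 ≤ ∣ U ∣ → Connected G → 1 ≤ n → ∀ X → Proper {Σᶠ U λ _ → V} X →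
    edgeConnectivity G * n ^ 2 ≤ H.cut X ⊎ minDegree H ≤ H.cut X
  lower-bound 2≤U connected 1≤n X ((a , x) , (b , y) , ax∈ , by∉)
    with All.all? (unsplit? X) U.E
  ... | yes unsplit = inj₁ (≤-trans
    (edgeConnectivity≤cutˢ (shares X) side pure-shares (a , b , a∈ , b∉)) (cutˢ≤cut X))
    where
    side : Carrier U → Bool
    side c = does (outside (shares X c) ℕ.≟ 0)

    -- `(a , x)` lies in `X`, so the fibre over `a` is not empty and, being unsplit, is full;
    -- dually, `(b , y)` keeps the fibre over `b` from being full.
    a∈ : side a ≡ true
    a∈ with All.lookup unsplit (U.complete a)
    ... | inj₁ in≡0  = contradiction in≡0 (>⇒≢ (inside-positive X ax∈))
    ... | inj₂ out≡0 = dec-true (outside (shares X a) ℕ.≟ 0) out≡0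

    b∉ : side b ≡ false
    b∉ = dec-false (outside (shares X b) ℕ.≟ 0) (>⇒≢ (outside-positive X by∉))

    pure-shares : Pure (shares X) side
    pure-shares c = unsplit⇒pure (shares X c) (All.lookup unsplit (U.complete c))
  ... | no split with find (All.¬All⇒Any¬ (unsplit? X) U.E split)
  ...   | c , _ , c-split with cutˢ-bounds 2≤U (shares X) c
  ...     | inj₁ λ≤        = inj₁ (≤-trans λ≤ (cutˢ≤cut X))
  ...     | inj₂ (inj₁ k≤) =
    inj₂ (vertex-bound 2≤U connected 1≤n X c (fibre X c) (c-split ∘ inj₁) k≤ ≤-refl)
  -- This bound concerns the vertices over `c` outside `X`; as a set they have the same cut within
  -- the fibre.
  ...     | inj₂ (inj₂ m≤) =
    inj₂ (vertex-bound 2≤U connected 1≤n X c (not ∘ fibre X c) (c-split ∘ inj₂) m≤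
      (≤-reflexive (F.cut-complement c (fibre X c))))

-- Combination of the upper and lower bounds.

theorem2p9 : ∀ {i} {U V : FiniteSet} (G : Graph U) {I : Set i} (Γ : I → Graph V) →
    2 ≤ ∣ U ∣ →
    Connected G →
    (∀ j → Nontrivial (Γ j)) →
    (h : Carrier U → I) →
    edgeConnectivity (G ∘⟨ h ⟩ Γ) ≡ (edgeConnectivity G * ∣ V ∣ ^ 2) ⊓ minDegree (G ∘⟨ h ⟩ Γ)
theorem2p9 {U = U} {V} G Γ 2≤U connected nontrivial h = ≤-antisym
  (⊓-glb (edgeConnectivity≤lifted 2≤U 2≤V) (H.edgeConnectivity≤minDegree 2≤UV))
  (decidable-stable (_ ≤? _) λ ≰ → H.cut-attained 2≤UV λ (X , proper , cut≤) →
    ≰ (≤-trans (below X (lower-bound 2≤U connected (≤-trans (s≤s z≤n) 2≤V) X proper)) cut≤))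
  where
  open Product G Γ h

  2≤V : 2 ≤ ∣ V ∣
  -- Nontriviality is stated per index, so an index is needed; `h` supplies one at a vertex of `G`.
  2≤V = nontrivial (h (proj₁ (Enumeration.distinct U 2≤U)))

  2≤UV : 2 ≤ ∣ Σᶠ U (λ _ → V) ∣
  2≤UV = ≤-trans (*-mono-≤ 2≤U (≤-trans (s≤s z≤n) 2≤V)) (≤-reflexive (sym (length-Σᶠ U V)))

  below : ∀ X → edgeConnectivity G * n ^ 2 ≤ H.cut X ⊎ minDegree H ≤ H.cut X →
          (edgeConnectivity G * n ^ 2) ⊓ minDegree H ≤ H.cut X
  below X (inj₁ λ≤) = ≤-trans (m⊓n≤m _ _) λ≤
  below X (inj₂ δ≤) = ≤-trans (m⊓n≤n (edgeConnectivity G * n ^ 2) _) δ≤
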